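{- Let $\mathcal{R}$ be a symmetric $d$-class association scheme with $d\geq 3$, and let $\Gamma$ be its fusing-relations graph. If $\Gamma$ is a connected graph that is not a path, then $\mathcal{R}$ is amorphic.
   Context: A symmetric $d$-class association scheme on a finite set $X$ with $|X|=v$ is a set $\mathcal{R}=\{A_0,A_1,\dots,A_d\}$ of $X\times X$ $01$-matrices ("relations") with $A_0=I$, $A_0+\dots+A_d=J$, $A_i^\top=A_i$, and $A_iA_j=\sum_h p_{ij}^hA_h$ for constants $p_{ij}^h$. For a partition $\pi=\{\pi(0),\dots,\pi(d')\}$ of $\{0,\dots,d\}$ with $\pi(0)=\{0\}$, put $A_{\pi(i)}=\sum_{l\in\pi(i)}A_l$; if $\{A_{\pi(i)}\}$ is again an association scheme it is called a fusion scheme. $\mathcal{R}$ is amorphic if every such partition gives a fusion scheme. A pair $\{A_i,A_j\}$ of non-trivial relations ($i\ne j$, $i,j\ge1$) fuses if replacing $A_i,A_j$ by $A_i+A_j$ (keeping all other relations) yields an association scheme. The fusing-relations graph of $\mathcal{R}$ is the graph on vertex set $\{1,\dots,d\}$ in which $i,j$ are adjacent iff $\{A_i,A_j\}$ fuses. -}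

module Defs where

open import Data.Nat using (ℕ; zero; suc; _≥_)
open import Data.Fin using (Fin; zero; suc; toℕ; _≟_)
open import Data.List using (List; length; filter; allFin)
open import Data.Product using (Σ; ∃; _×_; _,_)
open import Data.Sum using (_⊎_)
open import Relation.Nullary using (¬_)
open import Data.Empty using (⊥)
open import Relation.Nullary.Decidable using (_×-dec_)
open import Relation.Binary.PropositionalEquality using (_≡_; _≢_)
open import Relation.Binary.Construct.Closure.ReflexiveTransitive using (Star)
open import Function using (_∘_)
open import Function.Bundles using (_⇔_; _↔_; Inverse)

-- A symmetric scheme on X = Fin v with classes 0..d is encoded by the
-- "colouring" R : X → X → Fin (suc d) with R x y = i iff (A_i)_{xy} = 1.
-- This encodes exactly the 01-matrices A_0,…,A_d with A_0+…+A_d = J.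
Colouring : ℕ → ℕ → Set
Colouring v d = Fin v → Fin v → Fin (suc d)

-- (A_i A_j)_{xy} = #{ z | R x z = i and R z y = j }
prodEntry : ∀ {v d} → Colouring v d → Fin (suc d) → Fin (suc d) → Fin v → Fin v → ℕ
prodEntry R i j x y = length (filter (λ z → (R x z ≟ i) ×-dec (R z y ≟ j)) (allFin _))

-- R is a symmetric d-class association scheme:
--  A_0 = I, every A_i is a nonzero matrix (the d+1 matrices are distinct),
--  A_i symmetric, and A_i A_j = Σ_h p_ij^h A_h.
record IsSymScheme {v d : ℕ} (R : Colouring v d) : Set where
  field
    identity    : ∀ x y → (R x y ≡ zero) ⇔ (x ≡ y)
    nonempty    : ∀ i → ∃ λ x → ∃ λ y → R x y ≡ i
    symmetric   : ∀ x y → R x y ≡ R y x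
    intersection : Σ (Fin (suc d) → Fin (suc d) → Fin (suc d) → ℕ) λ p →
                     ∀ i j x y → prodEntry R i j x y ≡ p i j (R x y)

recolour : ∀ {v d d'} → (Fin (suc d) → Fin (suc d')) → Colouring v d → Colouring v d'
recolour f R x y = f (R x y)

-- A partition π of {0..d} with π(0) = {0} into d'+1 cells is given by a
-- surjective map f : Fin (suc d) → Fin (suc d') with f i = 0 iff i = 0;
-- the fused relations A_{π(k)} correspond to the colouring f ∘ R.
IsFusionPartition : ∀ {d d'} → (Fin (suc d) → Fin (suc d')) → Set
IsFusionPartition {d} {d'} f =
  (∀ (k : Fin (suc d')) → ∃ λ i → f i ≡ k) × (∀ i → (f i ≡ zero) ⇔ (i ≡ zero))

Amorphic : ∀ {v d} → Colouring v d → Set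
Amorphic {v} {d} R = ∀ (d' : ℕ) (f : Fin (suc d) → Fin (suc d')) →
  IsFusionPartition f → IsSymScheme (recolour f R)

-- The pair {A_i, A_j} (i ≠ j, both nonzero) fuses: merging exactly the
-- classes i and j (all other classes kept) gives an association scheme.
-- The merged scheme is written with a labelling f : Fin (suc d) → Fin d of
-- the d resulting classes whose kernel is exactly {i,j} plus singletons.
Fuses : ∀ {v d} → Colouring v d → Fin (suc d) → Fin (suc d) → Set
-- d = 0: there is no pair of distinct non-trivial relations
Fuses {v} {zero} R i j = ⊥
Fuses {v} {suc d} R i j =
  i ≢ j × i ≢ zero × j ≢ zero ×
  (Σ (Fin (suc (suc d)) → Fin (suc d)) λ f →
     (∀ k l → (f k ≡ f l) ⇔ (k ≡ l ⊎ (k ≡ i × l ≡ j) ⊎ (k ≡ j × l ≡ i)))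
     × IsSymScheme (recolour f R))

FRAdj : ∀ {v d} → Colouring v d → Fin d → Fin d → Set
FRAdj R a b = Fuses R (suc a) (suc b)

Connected : ∀ {n} → (Fin n → Fin n → Set) → Set
Connected {n} adj = ∀ a b → Star adj a b

Consecutive : ∀ {n} → Fin n → Fin n → Set
Consecutive a b = suc (toℕ a) ≡ toℕ b ⊎ suc (toℕ b) ≡ toℕ a

IsPath : ∀ {n} → (Fin n → Fin n → Set) → Set
IsPath {n} adj = Σ (Fin n ↔ Fin n) λ σ →
  ∀ a b → adj (Inverse.to σ a) (Inverse.to σ b) ⇔ Consecutive a b

{-# OPTIONS --safe #-}

-- The argument is combinatorial and uses no eigenvalues. Put q(a,b,c) = p_ab^c / (k_a k_b), which is
-- symmetric in a, b, c. If {i,j} fuses then q(a,b,i) = q(a,b,j) for all a, b outside {i,j}. Viewing a, b, c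
-- as three tokens that slide along the edges of the connected graph Γ, q takes one value q₀ on all
-- triples of distinct nontrivial relations. Summing k_c q(a,b,c) over c shows that
-- w(a,b) = k_a (q(a,a,b) - q₀) satisfies w(a,b) + w(b,a) = const for a ≠ b, while w(a,b) = w(a,c)
-- for every edge {b,c} avoiding a. These two rules carry the unordered pair {w(x,y), w(y,x)} of one edge
-- to every pair of distinct vertices. If its members are equal, q(a,a,·) is constant off a, and then
-- every pair, hence every partition, fuses. If they differ, a ≺ b :⇔ w(a,b) = w(x,y) is a linear order
-- in which adjacent means consecutive, so Γ is a path.
module Submission where

open import Defs
open import Data.Nat using (ℕ; zero; suc; _+_; _*_; _∸_; _≤_; _<_; _≥_; z≤n; s≤s; NonZero; >-nonZero)
open import Data.Nat.Divisibility using (_∣_; quotient)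
open import Data.Nat.ListAction using (product)
open import Data.Nat.ListAction.Properties using (product≢0; ∈⇒∣product)
open import Data.Nat.Tactic.RingSolver using (solve-∀)
open import Data.List using (length; filter; tabulate)
open import Data.List.Membership.Propositional.Properties using (∈-tabulate⁺)
import Data.List.Relation.Unary.All.Properties as All
import Data.Nat.Properties as ℕ
open import Algebra.Properties.CommutativeSemigroup ℕ.*-commutativeSemigroup using (x∙yz≈y∙xz)
open import Data.Fin using (Fin; zero; suc; toℕ; fromℕ<; punchOut; _≟_)
open import Data.Fin.Properties using (any?; punchOut-injective; injective⇒≤; toℕ-fromℕ<)
open import Data.Empty using (⊥-elim)
open import Data.Product using (Σ; ∃; _×_; _,_; proj₁; proj₂)
open import Data.Sum using (_⊎_; inj₁; inj₂)
open import Function.Bundles using (_⇔_; mk⇔; mk↔ₛ′; Equivalence)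
open import Function.Definitions using (Injective)
open import Relation.Binary.Construct.Closure.ReflexiveTransitive using (Star; ε; _◅_)
open import Relation.Binary.PropositionalEquality hiding ([_])
open import Relation.Nullary using (¬_; Dec; yes; no; contradiction)
open import Relation.Nullary.Decidable using (_×-dec_; ¬?)
open import Algebra.Properties.Semiring.Sum ℕ.+-*-semiring
  using (sum; sum-cong-≗; ∑-distrib-+; ∑-comm; *-distribˡ-sum; *-distribʳ-sum; sum-replicate-zero)

-- Indicators, finite sums and the pigeonhole principle.

private variable
  n : ℕ
  A B : Set

⟦_⟧ : Dec A → ℕ
⟦ yes _ ⟧ = 1
⟦ no _ ⟧ = 0

⟦⟧-yes : A → (A? : Dec A) → ⟦ A? ⟧ ≡ 1
⟦⟧-yes a (yes _) = refl
⟦⟧-yes a (no ¬a) = contradiction a ¬a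

⟦⟧-no : ¬ A → (A? : Dec A) → ⟦ A? ⟧ ≡ 0
⟦⟧-no ¬a (yes a) = contradiction a ¬a
⟦⟧-no ¬a (no _) = refl

⟦⟧-cong : A ⇔ B → (A? : Dec A) (B? : Dec B) → ⟦ A? ⟧ ≡ ⟦ B? ⟧
⟦⟧-cong A⇔B (yes a) B? = sym (⟦⟧-yes (Equivalence.to A⇔B a) B?)
⟦⟧-cong A⇔B (no ¬a) B? = sym (⟦⟧-no (λ b → ¬a (Equivalence.from A⇔B b)) B?)

⟦⟧-× : (A? : Dec A) (B? : Dec B) → ⟦ A? ×-dec B? ⟧ ≡ ⟦ A? ⟧ * ⟦ B? ⟧
⟦⟧-× (yes _) (yes _) = refl
⟦⟧-× (yes _) (no _) = refl
⟦⟧-× (no _) _ = refl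

sum-zero : (f : Fin n → ℕ) → (∀ i → f i ≡ 0) → sum f ≡ 0
sum-zero {n} f f≡0 = trans (sum-cong-≗ f≡0) (sum-replicate-zero n)

sum-mono-≤ : {f g : Fin n → ℕ} → (∀ i → f i ≤ g i) → sum f ≤ sum g
sum-mono-≤ {zero} f≤g = z≤n
sum-mono-≤ {suc n} f≤g = ℕ.+-mono-≤ (f≤g zero) (sum-mono-≤ (λ i → f≤g (suc i)))

sum-ones : ∀ n → sum {n} (λ _ → 1) ≡ n
sum-ones zero = refl
sum-ones (suc n) = cong suc (sum-ones n)

sum-select : (a : Fin n) (f : Fin n → ℕ) → sum (λ i → ⟦ i ≟ a ⟧ * f i) ≡ f a
sum-select zero f = begin
  f zero + 0 + sum (λ i → ⟦ suc i ≟ zero ⟧ * f (suc i)) ≡⟨ cong₂ _+_ (ℕ.+-identityʳ _)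
                                                              (sum-zero (λ i → ⟦ suc i ≟ zero ⟧ * f (suc i)) (λ _ → refl)) ⟩
  f zero + 0 ≡⟨ ℕ.+-identityʳ _ ⟩
  f zero ∎
  where open ≡-Reasoning
sum-select (suc a) f = trans
  (sum-cong-≗ (λ i → cong (_* f (suc i)) (⟦⟧-cong (mk⇔ (λ { refl → refl }) (cong suc)) (suc i ≟ suc a) (i ≟ a))))
  (sum-select a (λ i → f (suc i)))

sum-fibre : (a : Fin n) (f : Fin n → ℕ) → sum (λ i → ⟦ a ≟ i ⟧ * f i) ≡ f a
sum-fibre a f = trans
  (sum-cong-≗ (λ i → cong (_* f i) (⟦⟧-cong (mk⇔ sym sym) (a ≟ i) (i ≟ a))))
  (sum-select a f)

term≤sum : (f : Fin n → ℕ) (a : Fin n) → f a ≤ sum f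
term≤sum f zero = ℕ.m≤m+n (f zero) _
term≤sum f (suc a) = ℕ.≤-trans (term≤sum (λ i → f (suc i)) a) (ℕ.m≤n+m _ (f zero))

sum-+-indicator : (a : Fin n) (f : Fin n → ℕ) (x : ℕ) →
                  sum (λ i → f i + ⟦ i ≟ a ⟧ * x) ≡ sum f + x
sum-+-indicator a f x =
  trans (∑-distrib-+ f _) (cong (sum f +_) (sum-select a (λ _ → x)))

module _ {f g : Fin n → ℕ} (a : Fin n) where

  -- Adding `g a` to `f` and `f a` to `g` at position `a` makes the two functions equal everywhere.
  -- The crossed form avoids subtraction in ℕ.
  sum-agree-off₁ : (∀ i → i ≢ a → f i ≡ g i) → sum f + g a ≡ sum g + f a
  sum-agree-off₁ f≗g = begin
    sum f + g a                       ≡⟨ sum-+-indicator a f (g a) ⟨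
    sum (λ i → f i + ⟦ i ≟ a ⟧ * g a) ≡⟨ sum-cong-≗ pointwise ⟩
    sum (λ i → g i + ⟦ i ≟ a ⟧ * f a) ≡⟨ sum-+-indicator a g (f a) ⟩
    sum g + f a                       ∎
    where
    open ≡-Reasoning
    pointwise : ∀ i → f i + ⟦ i ≟ a ⟧ * g a ≡ g i + ⟦ i ≟ a ⟧ * f a
    pointwise i with i ≟ a
    ... | yes refl = begin
      f a + 1 * g a ≡⟨ cong (f a +_) (ℕ.*-identityˡ (g a)) ⟩
      f a + g a     ≡⟨ ℕ.+-comm (f a) (g a) ⟩
      g a + f a     ≡⟨ cong (g a +_) (ℕ.*-identityˡ (f a)) ⟨
      g a + 1 * f a ∎
    ... | no i≢a = cong (_+ 0) (f≗g i i≢a)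

  equal-sums-agree : (∀ i → i ≢ a → f i ≡ g i) → sum f ≡ sum g → f a ≡ g a
  equal-sums-agree f≗g ∑f≡∑g = sym (ℕ.+-cancelˡ-≡ (sum f) _ _
    (trans (sum-agree-off₁ f≗g) (cong (_+ f a) (sym ∑f≡∑g))))

sum-agree-off₂ : {f g : Fin n → ℕ} (a b : Fin n) → a ≢ b →
  (∀ i → i ≢ a → i ≢ b → f i ≡ g i) → sum f + (g a + g b) ≡ sum g + (f a + f b)
sum-agree-off₂ {f = f} {g} a b a≢b f≗g = begin
  sum f + (g a + g b)            ≡⟨ expand f (g a) (g b) ⟨
  sum (patched f (g a) (g b))    ≡⟨ sum-cong-≗ pointwise ⟩
  sum (patched g (f a) (f b))    ≡⟨ expand g (f a) (f b) ⟩
  sum g + (f a + f b)            ∎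
  where
  open ≡-Reasoning
  patched : (Fin _ → ℕ) → ℕ → ℕ → Fin _ → ℕ
  patched h x y i = h i + ⟦ i ≟ a ⟧ * x + ⟦ i ≟ b ⟧ * y
  expand : ∀ h x y → sum (patched h x y) ≡ sum h + (x + y)
  expand h x y = trans (sum-+-indicator b _ y)
    (trans (cong (_+ y) (sum-+-indicator a h x)) (ℕ.+-assoc (sum h) x y))
  pointwise : ∀ i → patched f (g a) (g b) i ≡ patched g (f a) (f b) i
  pointwise i with i ≟ a | i ≟ b
  ... | yes refl | yes refl = contradiction refl a≢b
  ... | no i≢a | no i≢b = cong (λ x → x + 0 + 0) (f≗g i i≢a i≢b)
  ... | yes refl | no _ = cong (_+ 0) (begin
    f i + 1 * g i ≡⟨ cong (f i +_) (ℕ.*-identityˡ (g i)) ⟩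
    f i + g i     ≡⟨ ℕ.+-comm (f i) (g i) ⟩
    g i + f i     ≡⟨ cong (g i +_) (ℕ.*-identityˡ (f i)) ⟨
    g i + 1 * f i ∎)
  ... | no _ | yes refl = begin
    f i + 0 + 1 * g i ≡⟨ cong₂ _+_ (ℕ.+-identityʳ (f i)) (ℕ.*-identityˡ (g i)) ⟩
    f i + g i         ≡⟨ ℕ.+-comm (f i) (g i) ⟩
    g i + f i         ≡⟨ cong₂ _+_ (ℕ.+-identityʳ (g i)) (ℕ.*-identityˡ (f i)) ⟨
    g i + 0 + 1 * f i ∎

-- If `y` were missed, punching it out of the codomain would inject `Fin (suc n)` into `Fin n`.
Fin-injective⇒surjective : {f : Fin n → Fin n} → Injective _≡_ _≡_ f → ∀ y → ∃ λ x → f x ≡ y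
Fin-injective⇒surjective {suc n} {f} f-inj y with any? (λ x → f x ≟ y)
... | yes p = p
... | no ¬p = contradiction (injective⇒≤ avoid-injective) ℕ.1+n≰n
  where
  y≢f : ∀ x → y ≢ f x
  y≢f x y≡fx = ¬p (x , sym y≡fx)
  avoid-injective : Injective _≡_ _≡_ (λ x → punchOut (y≢f x))
  avoid-injective {x} {x′} eq = f-inj (punchOut-injective (y≢f x) (y≢f x′) eq)

-- Connected graphs: orders that are local along edges.

module Graph {n : ℕ} (_~_ : Fin n → Fin n → Set)
  (~-sym : ∀ {a b} → a ~ b → b ~ a) (~-irrefl : ∀ {a} → ¬ a ~ a)
  (connected : Connected _~_) where

  private
    V : Set
    V = Fin n

  module Ordered (_≺_ : V → V → Set) (_≺?_ : ∀ a b → Dec (a ≺ b))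
    (≺-total : ∀ {a b} → a ≢ b → a ≺ b ⊎ b ≺ a)
    (≺-asym : ∀ {a b} → a ≺ b → ¬ b ≺ a)
    (≺-local : ∀ {a b c} → b ~ c → a ≢ b → a ≢ c → a ≺ b → a ≺ c) where

    ≺-irrefl : ∀ {a} → ¬ a ≺ a
    ≺-irrefl p = ≺-asym p p

    ≺⇒≢ : ∀ {a b} → a ≺ b → a ≢ b
    ≺⇒≢ p refl = ≺-irrefl p

    -- Inclusion of down-sets is transitive by definition. Its totality, propagated along walks,
    -- yields transitivity of `≺`.
    _⊑_ : V → V → Set
    a ⊑ b = ∀ x → x ≺ a → x ≺ b

    -- Locality applies to every vertex off the edge. With `⊑-down` this shows that the down-set of
    -- `c` is that of `b` with `b` added.
    ⊑-up : ∀ {b c} → b ~ c → b ≺ c → b ⊑ c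
    ⊑-up b~c b≺c x x≺b = ≺-local b~c (≺⇒≢ x≺b) (λ { refl → ≺-asym b≺c x≺b }) x≺b

    ⊑-down : ∀ {b c x} → b ~ c → b ≺ c → x ≢ b → x ≺ c → x ≺ b
    ⊑-down b~c b≺c x≢b x≺c = ≺-local (~-sym b~c) (≺⇒≢ x≺c) x≢b x≺c

    -- The down-sets of `b` and `c` differ in a single vertex, the lower end of the edge, so only
    -- that vertex can spoil an inclusion.
    ⊑-step : ∀ {a b c} → b ~ c → a ⊑ b ⊎ b ⊑ a → a ⊑ c ⊎ c ⊑ a
    ⊑-step {a} {b} {c} b~c comparable with a ≟ b
    ... | yes refl with ≺-total (λ { refl → ~-irrefl b~c })
    ...   | inj₁ b≺c = inj₁ (⊑-up b~c b≺c)
    ...   | inj₂ c≺b = inj₂ (⊑-up (~-sym b~c) c≺b)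
    ⊑-step {a} {b} {c} b~c comparable
        | no a≢b with ≺-total (λ { refl → ~-irrefl b~c }) | ≺-total a≢b | comparable
    ...   | inj₁ b≺c | _ | inj₁ a⊑b = inj₁ (λ x x≺a → ⊑-up b~c b≺c x (a⊑b x x≺a))
    ...   | inj₁ b≺c | inj₁ a≺b | inj₂ b⊑a = ⊥-elim (≺-irrefl (b⊑a a a≺b))
    ...   | inj₁ b≺c | inj₂ b≺a | inj₂ b⊑a = inj₂ below
      where
      below : c ⊑ a
      below x x≺c with x ≟ b
      ... | yes refl = b≺a
      ... | no x≢b = b⊑a x (⊑-down b~c b≺c x≢b x≺c)
    ...   | inj₂ c≺b | _ | inj₂ b⊑a = inj₂ (λ x x≺c → b⊑a x (⊑-up (~-sym b~c) c≺b x x≺c))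
    ...   | inj₂ c≺b | inj₂ b≺a | inj₁ a⊑b = ⊥-elim (≺-irrefl (a⊑b b b≺a))
    ...   | inj₂ c≺b | inj₁ a≺b | inj₁ a⊑b with c ≟ a
    ...     | yes refl = inj₁ (λ x x≺a → x≺a)
    -- Passing down to `c` loses only `c` itself, which is not below `a`: locality turns `a ≺ b`
    -- into `a ≺ c`.
    ...     | no c≢a = inj₁ (λ x x≺a → ⊑-down (~-sym b~c) c≺b
                  (λ { refl → ≺-asym x≺a (≺-local b~c a≢b (λ { refl → c≢a refl }) a≺b) }) (a⊑b x x≺a))

    ⊑-total : ∀ a b → a ⊑ b ⊎ b ⊑ a
    ⊑-total a b = go (connected a b) (inj₁ (λ x x≺a → x≺a))
      where
      go : ∀ {c} → Star _~_ c b → a ⊑ c ⊎ c ⊑ a → a ⊑ b ⊎ b ⊑ a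
      go ε p = p
      go (c~c′ ◅ path) p = go path (⊑-step c~c′ p)

    -- This is transitivity of `≺`: the opposite inclusion would put `a` below itself.
    ≺⇒⊑ : ∀ {a b} → a ≺ b → a ⊑ b
    ≺⇒⊑ {a} {b} a≺b with ⊑-total a b
    ... | inj₁ a⊑b = a⊑b
    ... | inj₂ b⊑a = ⊥-elim (≺-irrefl (b⊑a a a≺b))

    rank : V → ℕ
    rank a = sum (λ x → ⟦ x ≺? a ⟧)

    -- The summand is the indicator of the closed down-set of `a`; the rank estimates compare it
    -- pointwise with another indicator.
    sum-below-or-equal : ∀ a → sum (λ x → ⟦ x ≺? a ⟧ + ⟦ x ≟ a ⟧ * 1) ≡ suc (rank a)
    sum-below-or-equal a = trans (sum-+-indicator a (λ x → ⟦ x ≺? a ⟧) 1) (ℕ.+-comm (rank a) 1)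

    rank-mono : ∀ {a b} → a ≺ b → rank a < rank b
    rank-mono {a} {b} a≺b = subst (_≤ rank b) (sum-below-or-equal a) (sum-mono-≤ pointwise)
      where
      pointwise : ∀ x → ⟦ x ≺? a ⟧ + ⟦ x ≟ a ⟧ * 1 ≤ ⟦ x ≺? b ⟧
      pointwise x with x ≺? a | x ≟ a
      ... | yes x≺a | yes refl = ⊥-elim (≺-irrefl x≺a)
      ... | yes x≺a | no _ = ℕ.≤-reflexive (sym (⟦⟧-yes (≺⇒⊑ a≺b x x≺a) (x ≺? b)))
      ... | no _ | yes refl = ℕ.≤-reflexive (sym (⟦⟧-yes a≺b (x ≺? b)))
      ... | no _ | no _ = z≤n

    rank<n : ∀ a → rank a < n
    rank<n a = subst₂ _≤_ (sum-below-or-equal a) (sum-ones n) (sum-mono-≤ pointwise)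
      where
      pointwise : ∀ x → ⟦ x ≺? a ⟧ + ⟦ x ≟ a ⟧ * 1 ≤ 1
      pointwise x with x ≺? a | x ≟ a
      ... | yes x≺a | yes refl = ⊥-elim (≺-irrefl x≺a)
      ... | yes _ | no _ = ℕ.≤-refl
      ... | no _ | yes _ = ℕ.≤-refl
      ... | no _ | no _ = z≤n

    -- By `⊑-up` and `⊑-down` the closed down-set of `b` is the open down-set of `c`.
    rank-cover : ∀ {b c} → b ~ c → b ≺ c → suc (rank b) ≡ rank c
    rank-cover {b} {c} b~c b≺c = trans (sym (sum-below-or-equal b)) (sum-cong-≗ pointwise)
      where
      pointwise : ∀ x → ⟦ x ≺? b ⟧ + ⟦ x ≟ b ⟧ * 1 ≡ ⟦ x ≺? c ⟧
      pointwise x with x ≺? b | x ≟ b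
      ... | yes x≺b | yes refl = ⊥-elim (≺-irrefl x≺b)
      ... | yes x≺b | no _ = sym (⟦⟧-yes (⊑-up b~c b≺c x x≺b) (x ≺? c))
      ... | no _ | yes refl = sym (⟦⟧-yes b≺c (x ≺? c))
      ... | no x⊀b | no x≢b = sym (⟦⟧-no (λ x≺c → x⊀b (⊑-down b~c b≺c x≢b x≺c)) (x ≺? c))

    rank-injective : ∀ {a b} → rank a ≡ rank b → a ≡ b
    rank-injective {a} {b} eq with a ≟ b
    ... | yes a≡b = a≡b
    ... | no a≢b with ≺-total a≢b
    ...   | inj₁ a≺b = ⊥-elim (ℕ.<-irrefl eq (rank-mono a≺b))
    ...   | inj₂ b≺a = ⊥-elim (ℕ.<-irrefl (sym eq) (rank-mono b≺a))

    adjacent⇒consecutive : ∀ {a b} → a ~ b → suc (rank a) ≡ rank b ⊎ suc (rank b) ≡ rank a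
    adjacent⇒consecutive a~b with ≺-total (λ { refl → ~-irrefl a~b })
    ... | inj₁ a≺b = inj₁ (rank-cover a~b a≺b)
    ... | inj₂ b≺a = inj₂ (rank-cover (~-sym a~b) b≺a)

    -- Ranks change by one along a walk, so a walk from a to b must use the edge at which
    -- the rank first exceeds that of a; by injectivity of the rank this edge is a ~ b.
    successor⇒adjacent : ∀ {a b} → suc (rank a) ≡ rank b → a ~ b
    successor⇒adjacent {a} {b} ra+1≡rb = go (connected a b) ℕ.≤-refl
      where
      go : ∀ {c} → Star _~_ c b → rank c ≤ rank a → a ~ b
      go ε rb≤ra = ⊥-elim (ℕ.1+n≰n (subst (_≤ rank a) (sym ra+1≡rb) rb≤ra))
      go {c} (_◅_ {j = c′} c~c′ path) rc≤ra with rank c′ ℕ.≤? rank a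
      ... | yes rc′≤ra = go path rc′≤ra
      ... | no rc′≰ra with adjacent⇒consecutive c~c′
      ...   | inj₂ rc′+1≡rc = ⊥-elim (rc′≰ra (ℕ.<⇒≤ (subst (_≤ rank a) (sym rc′+1≡rc) rc≤ra)))
      ...   | inj₁ rc+1≡rc′ = subst₂ _~_ (rank-injective rc≡ra)
                (rank-injective (trans (sym rc+1≡rc′) (trans (cong suc rc≡ra) ra+1≡rb))) c~c′
        where
        rc≡ra : rank c ≡ rank a
        rc≡ra = ℕ.≤-antisym rc≤ra (ℕ.≤-pred (subst (rank a <_) (sym rc+1≡rc′) (ℕ.≰⇒> rc′≰ra)))

    -- Ranks inject the vertices into `Fin n`, hence biject. `IsPath` asks for the vertex at each
    -- position, so the inverse of the ranking comes first.
    path : IsPath _~_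
    path = mk↔ₛ′ unposition position position-inverse unposition-inverse
         , λ i j → mk⇔ (λ e → subst₂ Consec (rank-unposition i) (rank-unposition j) (adjacent⇒consecutive e))
                       (λ e → consec⇒adj (subst₂ Consec (sym (rank-unposition i)) (sym (rank-unposition j)) e))
      where
      Consec : ℕ → ℕ → Set
      Consec k l = suc k ≡ l ⊎ suc l ≡ k
      consec⇒adj : ∀ {a b} → Consec (rank a) (rank b) → a ~ b
      consec⇒adj (inj₁ e) = successor⇒adjacent e
      consec⇒adj (inj₂ e) = ~-sym (successor⇒adjacent e)
      position : V → Fin n
      position a = fromℕ< (rank<n a)
      toℕ-position : ∀ a → toℕ (position a) ≡ rank a
      toℕ-position a = toℕ-fromℕ< (rank<n a)
      position-injective : Injective _≡_ _≡_ position
      position-injective {a} {b} eq =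
        rank-injective (trans (sym (toℕ-position a)) (trans (cong toℕ eq) (toℕ-position b)))
      unposition : Fin n → V
      unposition i = proj₁ (Fin-injective⇒surjective position-injective i)
      unposition-inverse : ∀ i → position (unposition i) ≡ i
      unposition-inverse i = proj₂ (Fin-injective⇒surjective position-injective i)
      position-inverse : ∀ a → unposition (position a) ≡ a
      position-inverse a = position-injective (unposition-inverse (position a))
      rank-unposition : ∀ i → rank (unposition i) ≡ toℕ i
      rank-unposition i = trans (sym (toℕ-position (unposition i))) (cong toℕ (unposition-inverse i))

  -- Balanced local weights on pairs of vertices.

  module Weights (w : V → V → ℕ)
    (balanced : ∀ {a b c e} → a ≢ b → c ≢ e → w a b + w b a ≡ w c e + w e c)
    (local : ∀ {a b c} → b ~ c → a ≢ b → a ≢ c → w a b ≡ w a c) where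

    opposite : ∀ {a b c e} → a ≢ b → c ≢ e → w a b ≡ w c e → w b a ≡ w e c
    opposite {a} {b} {c} {e} a≢b c≢e eq =
      ℕ.+-cancelˡ-≡ (w a b) _ _ (trans (balanced a≢b c≢e) (cong (_+ w e c) (sym eq)))

    module Edge {x y : V} (x~y : x ~ y) where

      x≢y : x ≢ y
      x≢y refl = ~-irrefl x~y

      -- Equality of unordered pairs, since transport along walks may exchange the two orientations.
      Like : V → V → Set
      Like a b = (w a b ≡ w x y × w b a ≡ w y x) ⊎ (w a b ≡ w y x × w b a ≡ w x y)

      like-sym : ∀ {a b} → Like a b → Like b a
      like-sym (inj₁ (p , q)) = inj₂ (q , p)
      like-sym (inj₂ (p , q)) = inj₁ (q , p)

      like-cong : ∀ {a b c e} → a ≢ b → c ≢ e → w a b ≡ w c e → Like a b → Like c e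
      like-cong a≢b c≢e eq (inj₁ (p , q)) = inj₁ (trans (sym eq) p , trans (sym (opposite a≢b c≢e eq)) q)
      like-cong a≢b c≢e eq (inj₂ (p , q)) = inj₂ (trans (sym eq) p , trans (sym (opposite a≢b c≢e eq)) q)

      -- For `a ≢ c`, locality along `b ~ c` carries the pair {a, b} to {a, c}, and locality along
      -- `a ~ b` carries that to {b, c}.
      like-edge : ∀ {a b c} → a ~ b → b ~ c → Like a b → Like b c
      like-edge {a} {b} {c} a~b b~c like with a ≟ c
      ... | yes refl = like-sym like
      ... | no a≢c = like-sym (like-cong (λ { refl → ~-irrefl a~b }) (λ { refl → ~-irrefl b~c })
                       (trans (opposite (λ { refl → ~-irrefl a~b }) a≢c w-ab≡ac) w-ca≡cb) (like-sym like))
        where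
        w-ab≡ac : w a b ≡ w a c
        w-ab≡ac = local b~c (λ { refl → ~-irrefl a~b }) a≢c
        w-ca≡cb : w c a ≡ w c b
        w-ca≡cb = local a~b (λ { refl → a≢c refl }) (λ { refl → ~-irrefl b~c })

      -- The invariant along the walk is that every edge at the current vertex is like. At `x` it
      -- follows from the reference edge.
      like-edges : ∀ {a} → Star _~_ x a → ∀ {b} → a ~ b → Like a b
      like-edges path = go path (λ x~b → like-edge (~-sym x~y) x~b (inj₂ (refl , refl)))
        where
        go : ∀ {c a} → Star _~_ c a → (∀ {b} → c ~ b → Like c b) → ∀ {b} → a ~ b → Like a b
        go ε like = like
        go (c~c′ ◅ path) like = go path (λ c′~b → like-edge c~c′ c′~b (like c~c′))

      -- The walk is followed until it first meets `b`. Its last step is then an edge, and locality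
      -- handles the earlier steps with `b` held fixed.
      like-all : ∀ {a b} → a ≢ b → Like a b
      like-all {a} {b} = go (connected a b)
        where
        go : ∀ {a} → Star _~_ a b → a ≢ b → Like a b
        go ε a≢b = contradiction refl a≢b
        go {a} (_◅_ {j = a′} a~a′ path) a≢b with a′ ≟ b
        ... | yes refl = like-edges (connected x a) a~a′
        ... | no a′≢b = like-sym (like-cong b≢a′ b≢a (sym (local a~a′ b≢a b≢a′)) (like-sym (go path a′≢b)))
          where
          b≢a : b ≢ a
          b≢a refl = a≢b refl
          b≢a′ : b ≢ a′
          b≢a′ refl = a′≢b refl

      weights-constant : w x y ≡ w y x → ∀ {a b c} → a ≢ b → a ≢ c → w a b ≡ w a c
      weights-constant balanced-edge a≢b a≢c = trans (value (like-all a≢b)) (sym (value (like-all a≢c)))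
        where
        value : ∀ {a b} → Like a b → w a b ≡ w x y
        value (inj₁ (p , _)) = p
        value (inj₂ (p , _)) = trans p (sym balanced-edge)

      weights-path : w x y ≢ w y x → IsPath _~_
      weights-path unbalanced = Ordered.path _≺_ _≺?_ total asym ≺-local
        where
        _≺_ : V → V → Set
        a ≺ b = a ≢ b × w a b ≡ w x y
        _≺?_ : ∀ a b → Dec (a ≺ b)
        a ≺? b = ¬? (a ≟ b) ×-dec (w a b ℕ.≟ w x y)
        total : ∀ {a b} → a ≢ b → a ≺ b ⊎ b ≺ a
        total a≢b with like-all a≢b
        ... | inj₁ (p , _) = inj₁ (a≢b , p)
        ... | inj₂ (_ , q) = inj₂ ((λ { refl → a≢b refl }) , q)
        asym : ∀ {a b} → a ≺ b → ¬ b ≺ a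
        asym (a≢b , p) (_ , q) with like-all a≢b
        ... | inj₁ (_ , q′) = unbalanced (trans (sym q) q′)
        ... | inj₂ (p′ , _) = unbalanced (trans (sym p) p′)
        ≺-local : ∀ {a b c} → b ~ c → a ≢ b → a ≢ c → a ≺ b → a ≺ c
        ≺-local b~c a≢b a≢c (_ , p) = a≢c , trans (sym (local b~c a≢b a≢c)) p

    not-path⇒constant : ¬ IsPath _~_ → ∀ {a b c} → a ≢ b → a ≢ c → w a b ≡ w a c
    not-path⇒constant ¬path {a} {b} a≢b a≢c with connected a b
    ... | ε = contradiction refl a≢b
    -- Since `a ≢ b`, the walk has a first edge, which serves as the reference edge.
    ... | _◅_ {j = x} a~x _ with w a x ℕ.≟ w x a
    ...   | yes eq = Edge.weights-constant a~x eq a≢b a≢c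
    ...   | no neq = contradiction (Edge.weights-path a~x neq) ¬path

  -- Three tokens sliding on a connected graph.

  module Tokens (Q : V → V → V → ℕ)
    (Q-rotate : ∀ a b c → Q a b c ≡ Q b c a) (Q-swap : ∀ a b c → Q a b c ≡ Q b a c)
    (Q-slide : ∀ {a b x y} → x ~ y → a ≢ x → a ≢ y → b ≢ x → b ≢ y → Q a b x ≡ Q a b y) where

    -- If the walk from x to y is blocked by a token at a, that token first goes on to y
    -- and the one at x then takes its place.
    Q-move : ∀ {a b x y} → a ≢ b → a ≢ x → b ≢ x → a ≢ y → b ≢ y → Q a b x ≡ Q a b y
    Q-move {x = x} {y} = go (connected x y)
      where
      go : ∀ {a b x y} → Star _~_ x y → a ≢ b → a ≢ x → b ≢ x → a ≢ y → b ≢ y → Q a b x ≡ Q a b y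
      blocked : ∀ {a b x y} → x ~ a → Star _~_ a y → a ≢ b → a ≢ x → b ≢ x → a ≢ y → b ≢ y → Q a b x ≡ Q a b y
      go ε _ _ _ _ _ = refl
      go {a} {b} {x} {y} (_◅_ {j = z} x~z path) a≢b a≢x b≢x a≢y b≢y with z ≟ a | z ≟ b
      ... | yes refl | _ = blocked x~z path a≢b a≢x b≢x a≢y b≢y
      ... | no _ | yes refl = trans (Q-swap a b x) (trans (blocked x~z path (≢-sym a≢b) b≢x a≢x b≢y a≢y) (Q-swap b a y))
      ... | no z≢a | no z≢b = trans (Q-slide x~z a≢x (≢-sym z≢a) b≢x (≢-sym z≢b))
                                (go path a≢b (≢-sym z≢a) (≢-sym z≢b) a≢y b≢y)
      blocked {a} {b} {x} {y} x~a path a≢b a≢x b≢x a≢y b≢y with x ≟ y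
      ... | yes refl = refl
      ... | no x≢y = begin
        Q a b x ≡⟨ Q-rotate a b x ⟩
        Q b x a ≡⟨ go path b≢x (≢-sym a≢b) (≢-sym a≢x) b≢y x≢y ⟩
        Q b x y ≡⟨ trans (Q-rotate b x y) (Q-rotate x y b) ⟩
        Q y b x ≡⟨ Q-slide x~a (≢-sym x≢y) (≢-sym a≢y) b≢x (≢-sym a≢b) ⟩
        Q y b a ≡⟨ Q-rotate y b a ⟩
        Q b a y ≡⟨ Q-swap b a y ⟩
        Q a b y ∎
        where open ≡-Reasoning

    Distinct : V → V → V → Set
    Distinct a b c = a ≢ b × a ≢ c × b ≢ c

    Q-move₁ : ∀ {a b c a′} → Distinct a b c → a′ ≢ b → a′ ≢ c → Q a b c ≡ Q a′ b c
    Q-move₁ {a} {b} {c} {a′} (a≢b , a≢c , b≢c) a′≢b a′≢c = begin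
      Q a b c  ≡⟨ Q-rotate a b c ⟩
      Q b c a  ≡⟨ Q-move b≢c (≢-sym a≢b) (≢-sym a≢c) (≢-sym a′≢b) (≢-sym a′≢c) ⟩
      Q b c a′ ≡⟨ Q-rotate a′ b c ⟨
      Q a′ b c ∎
      where open ≡-Reasoning

    -- If `a′` already carries a token, symmetry of `Q` relabels it as the first; otherwise the
    -- first token moves there.
    Q-reach₁ : ∀ {a b c} a′ → Distinct a b c → ∃ λ b′ → ∃ λ c′ → Distinct a′ b′ c′ × Q a b c ≡ Q a′ b′ c′
    Q-reach₁ {a} {b} {c} a′ D@(a≢b , a≢c , b≢c) with a′ ≟ b | a′ ≟ c
    ... | yes refl | _ = c , a , (b≢c , ≢-sym a≢b , ≢-sym a≢c) , Q-rotate a b c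
    ... | no _ | yes refl = a , b , (≢-sym a≢c , ≢-sym b≢c , a≢b) , trans (Q-rotate a b c) (Q-rotate b c a)
    ... | no a′≢b | no a′≢c = b , c , (a′≢b , a′≢c , b≢c) , Q-move₁ D a′≢b a′≢c

    Q-reach₂ : ∀ {a b c b′} → Distinct a b c → a ≢ b′ → ∃ λ c′ → Distinct a b′ c′ × Q a b c ≡ Q a b′ c′
    Q-reach₂ {a} {b} {c} {b′} (a≢b , a≢c , b≢c) a≢b′ with b′ ≟ c
    ... | yes refl = b , (a≢c , a≢b , ≢-sym b≢c) , trans (Q-swap a b c) (Q-rotate b a c)
    ... | no b′≢c = c , (a≢b′ , a≢c , b′≢c) ,
      trans (Q-swap a b c) (trans (Q-move₁ (≢-sym a≢b , b≢c , a≢c) (≢-sym a≢b′) b′≢c) (Q-swap b′ a c))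

    -- The targets are occupied one at a time, and no token leaves a target once it has been placed
    -- there.
    Q-distinct : ∀ {a b c a′ b′ c′} → Distinct a b c → Distinct a′ b′ c′ → Q a b c ≡ Q a′ b′ c′
    Q-distinct {a′ = a′} D D′@(a′≢b′ , a′≢c′ , b′≢c′) with Q-reach₁ a′ D
    ... | b₁ , c₁ , D₁ , eq₁ with Q-reach₂ D₁ a′≢b′
    ... | c₂ , (_ , a′≢c₂ , b′≢c₂) , eq₂ =
      trans eq₁ (trans eq₂ (Q-move a′≢b′ a′≢c₂ b′≢c₂ a′≢c′ b′≢c′))

-- Matrix products as indicator sums, and common denominators.

length-filter-tabulate : {P : A → Set} (P? : ∀ x → Dec (P x)) (g : Fin n → A) →
  length (filter P? (tabulate g)) ≡ sum (λ i → ⟦ P? (g i) ⟧)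
length-filter-tabulate {n = zero} P? g = refl
length-filter-tabulate {n = suc n} P? g with P? (g zero)
... | yes _ = cong suc (length-filter-tabulate P? (λ i → g (suc i)))
... | no _ = length-filter-tabulate P? (λ i → g (suc i))

-- Applied to the valencies, this clears the denominators of q(a,b,c).
common-multiple : (k : Fin n → ℕ) → (∀ i → NonZero (k i)) →
  Σ ℕ λ M → NonZero M × Σ (Fin n → ℕ) λ m → ∀ i → m i * k i ≡ M
common-multiple k k≢0 = product (tabulate k) , product≢0 (All.tabulate⁺ k≢0)
  , (λ i → quotient (k∣M i)) , (λ i → sym (_∣_.equality (k∣M i)))
  where
  k∣M : ∀ i → k i ∣ product (tabulate k)
  k∣M i = ∈⇒∣product (∈-tabulate⁺ i)

module _ {v d : ℕ} (R : Colouring v d) where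

  prodEntry-sum : ∀ i j x y → prodEntry R i j x y ≡ sum (λ z → ⟦ R x z ≟ i ⟧ * ⟦ R z y ≟ j ⟧)
  prodEntry-sum i j x y = trans
    (length-filter-tabulate (λ z → (R x z ≟ i) ×-dec (R z y ≟ j)) (λ z → z))
    (sum-cong-≗ (λ z → ⟦⟧-× (R x z ≟ i) (R z y ≟ j)))

  prodEntry-transpose : (∀ x y → R x y ≡ R y x) → ∀ i j x y → prodEntry R i j x y ≡ prodEntry R j i y x
  prodEntry-transpose R-sym i j x y = begin
    prodEntry R i j x y                            ≡⟨ prodEntry-sum i j x y ⟩
    sum (λ z → ⟦ R x z ≟ i ⟧ * ⟦ R z y ≟ j ⟧)       ≡⟨ sum-cong-≗ pointwise ⟩
    sum (λ z → ⟦ R y z ≟ j ⟧ * ⟦ R z x ≟ i ⟧)       ≡⟨ prodEntry-sum j i y x ⟨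
    prodEntry R j i y x                            ∎
    where
    open ≡-Reasoning
    pointwise : ∀ z → ⟦ R x z ≟ i ⟧ * ⟦ R z y ≟ j ⟧ ≡ ⟦ R y z ≟ j ⟧ * ⟦ R z x ≟ i ⟧
    pointwise z = trans (ℕ.*-comm ⟦ R x z ≟ i ⟧ _)
      (cong₂ (λ k l → ⟦ k ≟ j ⟧ * ⟦ l ≟ i ⟧) (R-sym z y) (R-sym x z))

-- Intersection numbers of a symmetric scheme.

module Scheme {v d : ℕ} (R : Colouring v d) (scheme : IsSymScheme R) where

  open IsSymScheme scheme

  I : Set
  I = Fin (suc d)

  p : I → I → I → ℕ
  p = proj₁ intersection

  -- The valency: by symmetry, p_aa^0 counts the points in relation `a` to a given point.
  k : I → ℕ
  k a = p a a zero

  p-count : ∀ a b x y → sum (λ z → ⟦ R x z ≟ a ⟧ * ⟦ R z y ≟ b ⟧) ≡ p a b (R x y)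
  p-count a b x y = trans (sym (prodEntry-sum R a b x y)) (proj₂ intersection a b x y)

  -- Transposition reverses the factors of A_a A_b and fixes A_h.
  p-comm : ∀ a b h → p a b h ≡ p b a h
  p-comm a b h with nonempty h
  ... | x , y , refl = begin
    p a b (R x y)       ≡⟨ proj₂ intersection a b x y ⟨
    prodEntry R a b x y ≡⟨ prodEntry-transpose R symmetric a b x y ⟩
    prodEntry R b a y x ≡⟨ proj₂ intersection b a y x ⟩
    p b a (R y x)       ≡⟨ cong (p b a) (symmetric y x) ⟩
    p b a (R x y)       ∎
    where open ≡-Reasoning

  valency-row : ∀ x a → sum (λ z → ⟦ R x z ≟ a ⟧) ≡ k a
  valency-row x a = begin
    sum (λ z → ⟦ R x z ≟ a ⟧)                   ≡⟨ sum-cong-≗ (λ z → sym (pointwise z)) ⟩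
    sum (λ z → ⟦ R x z ≟ a ⟧ * ⟦ R z x ≟ a ⟧)    ≡⟨ p-count a a x x ⟩
    p a a (R x x)                              ≡⟨ cong (p a a) (Equivalence.from (identity x x) refl) ⟩
    k a                                        ∎
    where
    open ≡-Reasoning
    pointwise : ∀ z → ⟦ R x z ≟ a ⟧ * ⟦ R z x ≟ a ⟧ ≡ ⟦ R x z ≟ a ⟧
    pointwise z rewrite symmetric z x with R x z ≟ a
    ... | yes _ = refl
    ... | no _ = refl

  valency-column : ∀ y a → sum (λ z → ⟦ R z y ≟ a ⟧) ≡ k a
  valency-column y a = trans (sum-cong-≗ (λ z → cong (λ c → ⟦ c ≟ a ⟧) (symmetric z y))) (valency-row y a)

  k≢0 : ∀ a → NonZero (k a)
  k≢0 a with nonempty a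
  ... | x , y , Rxy≡a = >-nonZero (subst₂ _≤_ (⟦⟧-yes Rxy≡a (R x y ≟ a)) (valency-row x a)
                                    (term≤sum (λ z → ⟦ R x z ≟ a ⟧) y))

  -- A_0 is the identity, so A_0 A_b = A_b.
  p-zero : ∀ {b h} → b ≢ h → p zero b h ≡ 0
  p-zero {b} {h} b≢h with nonempty h
  ... | x , y , refl = trans (sym (p-count zero b x y)) (sum-zero _ pointwise)
    where
    pointwise : ∀ z → ⟦ R x z ≟ zero ⟧ * ⟦ R z y ≟ b ⟧ ≡ 0
    pointwise z with R x z ≟ zero
    ... | no _ = refl
    ... | yes Rxz≡0 with Equivalence.to (identity x z) Rxz≡0
    ...   | refl = trans (ℕ.*-identityˡ _) (⟦⟧-no (≢-sym b≢h) (R x y ≟ b))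

  -- Summing over `a` turns the left factor into J, and the entries of J A_b are the column sums of
  -- A_b.
  p-sum : ∀ b h → sum (λ a → p a b h) ≡ k b
  p-sum b h with nonempty h
  ... | x , y , refl = begin
    sum (λ a → p a b (R x y))                               ≡⟨ sum-cong-≗ (λ a → sym (p-count a b x y)) ⟩
    sum (λ a → sum (λ z → ⟦ R x z ≟ a ⟧ * ⟦ R z y ≟ b ⟧))    ≡⟨ ∑-comm (λ a z → ⟦ R x z ≟ a ⟧ * ⟦ R z y ≟ b ⟧) ⟩
    sum (λ z → sum (λ a → ⟦ R x z ≟ a ⟧ * ⟦ R z y ≟ b ⟧))    ≡⟨ sum-cong-≗ (λ z → sum-fibre (R x z) (λ _ → ⟦ R z y ≟ b ⟧)) ⟩
    sum (λ z → ⟦ R z y ≟ b ⟧)                               ≡⟨ valency-column y b ⟩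
    k b                                                    ∎
    where open ≡-Reasoning

  -- Both sides count the triangles with a vertex at a fixed point x.
  p-triangle : ∀ a b c → k c * p a b c ≡ k a * p c b a
  p-triangle a b c = trans (sym (triangles a b c)) (trans exchange (triangles c b a))
    where
    open ≡-Reasoning
    x : Fin v
    x = proj₁ (nonempty zero)
    triangles : ∀ a b c →
      sum (λ y → ⟦ R x y ≟ c ⟧ * sum (λ z → ⟦ R x z ≟ a ⟧ * ⟦ R z y ≟ b ⟧)) ≡ k c * p a b c
    triangles a b c = begin
      sum (λ y → ⟦ R x y ≟ c ⟧ * sum (λ z → ⟦ R x z ≟ a ⟧ * ⟦ R z y ≟ b ⟧)) ≡⟨ sum-cong-≗ pointwise ⟩
      sum (λ y → ⟦ R x y ≟ c ⟧ * p a b c)   ≡⟨ *-distribʳ-sum (p a b c) (λ y → ⟦ R x y ≟ c ⟧) ⟨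
      sum (λ y → ⟦ R x y ≟ c ⟧) * p a b c   ≡⟨ cong (_* p a b c) (valency-row x c) ⟩
      k c * p a b c                        ∎
      where
      pointwise : ∀ y → ⟦ R x y ≟ c ⟧ * sum (λ z → ⟦ R x z ≟ a ⟧ * ⟦ R z y ≟ b ⟧) ≡ ⟦ R x y ≟ c ⟧ * p a b c
      pointwise y with R x y ≟ c
      ... | yes Rxy≡c = cong (1 *_) (trans (p-count a b x y) (cong (p a b) Rxy≡c))
      ... | no _ = refl
    exchange : sum (λ y → ⟦ R x y ≟ c ⟧ * sum (λ z → ⟦ R x z ≟ a ⟧ * ⟦ R z y ≟ b ⟧))
             ≡ sum (λ y → ⟦ R x y ≟ a ⟧ * sum (λ z → ⟦ R x z ≟ c ⟧ * ⟦ R z y ≟ b ⟧))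
    exchange = begin
      sum (λ y → ⟦ R x y ≟ c ⟧ * sum (λ z → ⟦ R x z ≟ a ⟧ * ⟦ R z y ≟ b ⟧))
        ≡⟨ sum-cong-≗ (λ y → *-distribˡ-sum ⟦ R x y ≟ c ⟧ (λ z → ⟦ R x z ≟ a ⟧ * ⟦ R z y ≟ b ⟧)) ⟩
      sum (λ y → sum (λ z → ⟦ R x y ≟ c ⟧ * (⟦ R x z ≟ a ⟧ * ⟦ R z y ≟ b ⟧)))
        ≡⟨ ∑-comm (λ y z → ⟦ R x y ≟ c ⟧ * (⟦ R x z ≟ a ⟧ * ⟦ R z y ≟ b ⟧)) ⟩
      sum (λ z → sum (λ y → ⟦ R x y ≟ c ⟧ * (⟦ R x z ≟ a ⟧ * ⟦ R z y ≟ b ⟧)))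
        ≡⟨ sum-cong-≗ (λ z → sum-cong-≗ (λ y → pointwise z y)) ⟩
      sum (λ z → sum (λ y → ⟦ R x z ≟ a ⟧ * (⟦ R x y ≟ c ⟧ * ⟦ R y z ≟ b ⟧)))
        ≡⟨ sum-cong-≗ (λ z → sym (*-distribˡ-sum ⟦ R x z ≟ a ⟧ (λ y → ⟦ R x y ≟ c ⟧ * ⟦ R y z ≟ b ⟧))) ⟩
      sum (λ z → ⟦ R x z ≟ a ⟧ * sum (λ y → ⟦ R x y ≟ c ⟧ * ⟦ R y z ≟ b ⟧)) ∎
      where
      pointwise : ∀ z y → ⟦ R x y ≟ c ⟧ * (⟦ R x z ≟ a ⟧ * ⟦ R z y ≟ b ⟧)
                        ≡ ⟦ R x z ≟ a ⟧ * (⟦ R x y ≟ c ⟧ * ⟦ R y z ≟ b ⟧)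
      pointwise z y rewrite symmetric z y = x∙yz≈y∙xz ⟦ R x y ≟ c ⟧ ⟦ R x z ≟ a ⟧ ⟦ R y z ≟ b ⟧

  private
    multiple : Σ ℕ λ M → NonZero M × Σ (I → ℕ) λ m → ∀ a → m a * k a ≡ M
    multiple = common-multiple k k≢0

  M : ℕ
  M = proj₁ multiple

  -- The reciprocal valency, scaled by `M`.
  m : I → ℕ
  m = proj₁ (proj₂ (proj₂ multiple))

  m*k≡M : ∀ a → m a * k a ≡ M
  m*k≡M = proj₂ (proj₂ (proj₂ multiple))

  M≢0 : NonZero M
  M≢0 = proj₁ (proj₂ multiple)

  m≢0 : ∀ a → NonZero (m a)
  m≢0 a = ℕ.m*n≢0⇒m≢0 (m a) {k a} {{subst NonZero (sym (m*k≡M a)) M≢0}}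

  -- M² p_ab^c / (k_a k_b), scaled to stay in ℕ.
  Q : I → I → I → ℕ
  Q a b c = m a * m b * p a b c

  Q-cong : ∀ {a b c e} → p a b c ≡ p a b e → Q a b c ≡ Q a b e
  Q-cong {a} {b} = cong (m a * m b *_)

  Q-cancel : ∀ {a b c e} → Q a b c ≡ Q a b e → p a b c ≡ p a b e
  Q-cancel {a} {b} {c} {e} = ℕ.*-cancelˡ-≡ (p a b c) (p a b e) (m a * m b) {{ℕ.m*n≢0 (m a) (m b) {{m≢0 a}} {{m≢0 b}}}}

  Q-swap : ∀ a b c → Q a b c ≡ Q b a c
  Q-swap a b c = cong₂ _*_ (ℕ.*-comm (m a) (m b)) (p-comm a b c)

  -- This is `p-triangle` divided by k_a k_b k_c. With `Q-swap` it generates all permutations of the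
  -- arguments.
  Q-reverse : ∀ a b c → Q a b c ≡ Q c b a
  Q-reverse a b c = ℕ.*-cancelʳ-≡ (Q a b c) (Q c b a) M {{M≢0}} (begin
    Q a b c * M                         ≡⟨ cong (Q a b c *_) (m*k≡M c) ⟨
    Q a b c * (m c * k c)               ≡⟨ left (m a) (m b) (m c) (k c) (p a b c) ⟩
    m a * m b * m c * (k c * p a b c)   ≡⟨ cong (m a * m b * m c *_) (p-triangle a b c) ⟩
    m a * m b * m c * (k a * p c b a)   ≡⟨ right (m a) (m b) (m c) (k a) (p c b a) ⟩
    Q c b a * (m a * k a)               ≡⟨ cong (Q c b a *_) (m*k≡M a) ⟩
    Q c b a * M                         ∎)
    where
    open ≡-Reasoning
    left : ∀ ma mb mc k p → ma * mb * p * (mc * k) ≡ ma * mb * mc * (k * p)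
    left = solve-∀
    right : ∀ ma mb mc k p → ma * mb * mc * (k * p) ≡ mc * mb * p * (ma * k)
    right = solve-∀

  Q-rotate : ∀ a b c → Q a b c ≡ Q b c a
  Q-rotate a b c = trans (Q-reverse a b c) (Q-swap c b a)

  -- The weight k_c cancels one denominator; `p-sum` then supplies the k_a that cancels the other.
  Q-sum : ∀ a b → sum (λ c → k c * Q c a b) ≡ M * M
  Q-sum a b = begin
    sum (λ c → k c * Q c a b)              ≡⟨ sum-cong-≗ pointwise ⟩
    sum (λ c → M * m a * p c a b)          ≡⟨ *-distribˡ-sum (M * m a) (λ c → p c a b) ⟨
    M * m a * sum (λ c → p c a b)          ≡⟨ cong (M * m a *_) (p-sum a b) ⟩
    M * m a * k a                          ≡⟨ ℕ.*-assoc M (m a) (k a) ⟩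
    M * (m a * k a)                        ≡⟨ cong (M *_) (m*k≡M a) ⟩
    M * M                                  ∎
    where
    open ≡-Reasoning
    rearrange : ∀ k mc ma p → k * (mc * ma * p) ≡ mc * k * ma * p
    rearrange = solve-∀
    pointwise : ∀ c → k c * Q c a b ≡ M * m a * p c a b
    pointwise c = trans (rearrange (k c) (m c) (m a) (p c a b)) (cong (λ t → t * m a * p c a b) (m*k≡M c))

  Q-sum-nontrivial : ∀ {a b} → a ≢ b → sum (λ c → k (suc c) * Q (suc c) a b) ≡ M * M
  Q-sum-nontrivial {a} {b} a≢b = trans (cong (_+ sum (λ c → k (suc c) * Q (suc c) a b)) (sym vanishes)) (Q-sum a b)
    where
    vanishes : k zero * Q zero a b ≡ 0
    vanishes = trans (cong (λ t → k zero * (m zero * m a * t)) (p-zero a≢b))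
      (trans (cong (k zero *_) (ℕ.*-zeroʳ (m zero * m a))) (ℕ.*-zeroʳ (k zero)))

  -- The trace that fusing `i` and `j` leaves on the intersection numbers; `a` and `b` may coincide
  -- or be trivial.
  Interchangeable : I → I → Set
  Interchangeable i j = ∀ {a b} → a ≢ i → a ≢ j → b ≢ i → b ≢ j → p a b i ≡ p a b j

  -- Arbitrary fusions when all nontrivial relations are interchangeable.

  module Fusion (all-interchangeable : ∀ {i j} → i ≢ zero → j ≢ zero → Interchangeable i j)
    {d′ : ℕ} (f : I → Fin (suc d′)) (partition : IsFusionPartition f) where

    -- The coefficient of A_h in the product of two fused matrices. The fusion is a scheme once this
    -- depends only on `f h`.
    fused : Fin (suc d′) → Fin (suc d′) → I → ℕ
    fused s t h = sum (λ a → ⟦ f a ≟ s ⟧ * sum (λ b → ⟦ f b ≟ t ⟧ * p a b h))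

    -- Each `z` is sorted by its colours `R x z` and `R z y`, and the sums are exchanged.
    fused-count : ∀ s t x y → prodEntry (recolour f R) s t x y ≡ fused s t (R x y)
    fused-count s t x y = begin
      prodEntry (recolour f R) s t x y
        ≡⟨ prodEntry-sum (recolour f R) s t x y ⟩
      sum (λ z → S (R x z) * T (R z y))
        ≡⟨ sum-cong-≗ (λ z → sym (expand z)) ⟩
      sum (λ z → sum (λ a → sum (λ b → term a b z)))
        ≡⟨ ∑-comm (λ z a → sum (λ b → term a b z)) ⟩
      sum (λ a → sum (λ z → sum (λ b → term a b z)))
        ≡⟨ sum-cong-≗ (λ a → ∑-comm (λ z b → term a b z)) ⟩
      sum (λ a → sum (λ b → sum (λ z → term a b z)))
        ≡⟨ sum-cong-≗ (λ a → sum-cong-≗ (λ b → collect a b)) ⟩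
      sum (λ a → sum (λ b → S a * (T b * p a b (R x y))))
        ≡⟨ sum-cong-≗ (λ a → sym (*-distribˡ-sum (S a) (λ b → T b * p a b (R x y)))) ⟩
      fused s t (R x y) ∎
      where
      open ≡-Reasoning
      S T : I → ℕ
      S a = ⟦ f a ≟ s ⟧
      T b = ⟦ f b ≟ t ⟧
      term : I → I → Fin v → ℕ
      term a b z = ⟦ R x z ≟ a ⟧ * (⟦ R z y ≟ b ⟧ * (S a * T b))
      expand : ∀ z → sum (λ a → sum (λ b → term a b z)) ≡ S (R x z) * T (R z y)
      expand z = begin
        sum (λ a → sum (λ b → term a b z))
          ≡⟨ sum-cong-≗ (λ a → sym (*-distribˡ-sum ⟦ R x z ≟ a ⟧ (λ b → ⟦ R z y ≟ b ⟧ * (S a * T b)))) ⟩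
        sum (λ a → ⟦ R x z ≟ a ⟧ * sum (λ b → ⟦ R z y ≟ b ⟧ * (S a * T b)))
          ≡⟨ sum-fibre (R x z) (λ a → sum (λ b → ⟦ R z y ≟ b ⟧ * (S a * T b))) ⟩
        sum (λ b → ⟦ R z y ≟ b ⟧ * (S (R x z) * T b))
          ≡⟨ sum-fibre (R z y) (λ b → S (R x z) * T b) ⟩
        S (R x z) * T (R z y) ∎
      rearrange : ∀ α β γ δ → α * (β * (γ * δ)) ≡ γ * δ * (α * β)
      rearrange = solve-∀
      collect : ∀ a b → sum (λ z → term a b z) ≡ S a * (T b * p a b (R x y))
      collect a b = begin
        sum (λ z → term a b z)
          ≡⟨ sum-cong-≗ (λ z → rearrange ⟦ R x z ≟ a ⟧ ⟦ R z y ≟ b ⟧ (S a) (T b)) ⟩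
        sum (λ z → S a * T b * (⟦ R x z ≟ a ⟧ * ⟦ R z y ≟ b ⟧))
          ≡⟨ *-distribˡ-sum (S a * T b) (λ z → ⟦ R x z ≟ a ⟧ * ⟦ R z y ≟ b ⟧) ⟨
        S a * T b * sum (λ z → ⟦ R x z ≟ a ⟧ * ⟦ R z y ≟ b ⟧)
          ≡⟨ cong (S a * T b *_) (p-count a b x y) ⟩
        S a * T b * p a b (R x y)
          ≡⟨ ℕ.*-assoc (S a) (T b) _ ⟩
        S a * (T b * p a b (R x y)) ∎

    fused-comm : ∀ s t h → fused s t h ≡ fused t s h
    fused-comm s t h with nonempty h
    ... | x , y , refl = begin
      fused s t (R x y)                  ≡⟨ fused-count s t x y ⟨
      prodEntry (recolour f R) s t x y   ≡⟨ prodEntry-transpose (recolour f R) (λ x y → cong f (symmetric x y)) s t x y ⟩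
      prodEntry (recolour f R) t s y x   ≡⟨ fused-count t s y x ⟩
      fused t s (R y x)                  ≡⟨ cong (fused t s) (symmetric y x) ⟩
      fused t s (R x y)                  ∎
      where open ≡-Reasoning

    -- Summed over all cells the left factor is J, so the result is a fused valency, independent of
    -- `h`.
    fused-sum : ∀ t h → sum (λ s → fused s t h) ≡ sum (λ b → ⟦ f b ≟ t ⟧ * k b)
    fused-sum t h = begin
      sum (λ s → fused s t h)                           ≡⟨ ∑-comm (λ s a → ⟦ f a ≟ s ⟧ * X a) ⟩
      sum (λ a → sum (λ s → ⟦ f a ≟ s ⟧ * X a))          ≡⟨ sum-cong-≗ (λ a → sum-fibre (f a) (λ _ → X a)) ⟩
      sum (λ a → sum (λ b → ⟦ f b ≟ t ⟧ * p a b h))      ≡⟨ ∑-comm (λ a b → ⟦ f b ≟ t ⟧ * p a b h) ⟩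
      sum (λ b → sum (λ a → ⟦ f b ≟ t ⟧ * p a b h))      ≡⟨ sum-cong-≗ (λ b → sym (*-distribˡ-sum ⟦ f b ≟ t ⟧ (λ a → p a b h))) ⟩
      sum (λ b → ⟦ f b ≟ t ⟧ * sum (λ a → p a b h))      ≡⟨ sum-cong-≗ (λ b → cong (⟦ f b ≟ t ⟧ *_) (p-sum b h)) ⟩
      sum (λ b → ⟦ f b ≟ t ⟧ * k b)                      ∎
      where
      open ≡-Reasoning
      X : I → ℕ
      X a = sum (λ b → ⟦ f b ≟ t ⟧ * p a b h)

    module _ {i j : I} (fi≡fj : f i ≡ f j) (i≢0 : i ≢ zero) (j≢0 : j ≢ zero) where

      fused-off : ∀ {s t} → s ≢ f i → t ≢ f i → fused s t i ≡ fused s t j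
      fused-off {s} {t} s≢fi t≢fi = sum-cong-≗ outer
        where
        inner : ∀ a → f a ≡ s → ∀ b → ⟦ f b ≟ t ⟧ * p a b i ≡ ⟦ f b ≟ t ⟧ * p a b j
        inner a refl b with f b ≟ t
        ... | no _ = refl
        ... | yes refl = cong (1 *_) (all-interchangeable i≢0 j≢0
                (λ { refl → s≢fi refl }) (λ { refl → s≢fi (sym fi≡fj) })
                (λ { refl → t≢fi refl }) (λ { refl → t≢fi (sym fi≡fj) }))
        outer : ∀ a → ⟦ f a ≟ s ⟧ * sum (λ b → ⟦ f b ≟ t ⟧ * p a b i)
                    ≡ ⟦ f a ≟ s ⟧ * sum (λ b → ⟦ f b ≟ t ⟧ * p a b j)
        outer a with f a ≟ s
        ... | no _ = refl
        ... | yes fa≡s = cong (1 *_) (sum-cong-≗ (inner a fa≡s))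

      -- The totals over all cells agree by `fused-sum`, so agreement on the other cells forces
      -- agreement on the remaining one.
      fused-complete : ∀ {t} → (∀ s → s ≢ f i → fused s t i ≡ fused s t j) → fused (f i) t i ≡ fused (f i) t j
      fused-complete {t} agree = equal-sums-agree (f i) agree (trans (fused-sum t i) (sym (fused-sum t j)))

      fused-agree-offʳ : ∀ s {t} → t ≢ f i → fused s t i ≡ fused s t j
      fused-agree-offʳ s t≢fi with s ≟ f i
      ... | no s≢fi = fused-off s≢fi t≢fi
      ... | yes refl = fused-complete (λ s s≢fi → fused-off s≢fi t≢fi)

      fused-agree-offˡ : ∀ s {t} → s ≢ f i → fused s t i ≡ fused s t j
      fused-agree-offˡ s {t} s≢fi = trans (fused-comm s t i) (trans (fused-agree-offʳ t s≢fi) (fused-comm t s j))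

      -- Off the cell of `i` the sums agree termwise. Completion settles one argument in that cell,
      -- commutativity exchanges the arguments, and a second completion settles both.
      fused-agree : ∀ s t → fused s t i ≡ fused s t j
      fused-agree s t with t ≟ f i
      ... | no t≢fi = fused-agree-offʳ s t≢fi
      ... | yes refl with s ≟ f i
      ...   | no s≢fi = fused-agree-offˡ s s≢fi
      ...   | yes refl = fused-complete (λ s s≢fi → fused-agree-offˡ s s≢fi)

    fused-well-defined : ∀ s t {i j} → f i ≡ f j → fused s t i ≡ fused s t j
    fused-well-defined s t {i} {j} fi≡fj with i ≟ zero | j ≟ zero
    ... | yes refl | yes refl = refl
    ... | no i≢0 | no j≢0 = fused-agree fi≡fj i≢0 j≢0 s t
    ... | yes refl | no j≢0 = contradiction
            (Equivalence.to (proj₂ partition j) (trans (sym fi≡fj) (Equivalence.from (proj₂ partition zero) refl))) j≢0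
    ... | no i≢0 | yes refl = contradiction
            (Equivalence.to (proj₂ partition i) (trans fi≡fj (Equivalence.from (proj₂ partition zero) refl))) i≢0

    fusion-scheme : IsSymScheme (recolour f R)
    fusion-scheme = record
      { identity = λ x y → mk⇔
          (λ e → Equivalence.to (identity x y) (Equivalence.to (proj₂ partition (R x y)) e))
          (λ e → Equivalence.from (proj₂ partition (R x y)) (Equivalence.from (identity x y) e))
      ; nonempty = nonempty′
      ; symmetric = λ x y → cong f (symmetric x y)
      -- Structure constants are read at a chosen representative of each cell; `fused-well-defined`
      -- makes the choice immaterial.
      ; intersection = (λ s t h → fused s t (section h))
          , λ s t x y → trans (fused-count s t x y)
              (fused-well-defined s t (sym (f-section (f (R x y)))))
      }
      where
      section : Fin (suc d′) → I
      section h = proj₁ (proj₁ partition h)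
      f-section : ∀ h → f (section h) ≡ h
      f-section h = proj₂ (proj₁ partition h)
      nonempty′ : ∀ h → ∃ λ x → ∃ λ y → f (R x y) ≡ h
      nonempty′ h with nonempty (section h)
      ... | x , y , Rxy≡ = x , y , trans (cong f Rxy≡) (f-section h)

-- The fusing relation and intersection numbers.

fusing⇒interchangeable : ∀ {v d} {R : Colouring v d} (scheme : IsSymScheme R) {i j} →
  Fuses R i j → Scheme.Interchangeable R scheme i j
fusing⇒interchangeable {d = suc d} {R} scheme {i} {j} (_ , _ , _ , f , kernel , fusion) {a} {b} a≢i a≢j b≢i b≢j
  with IsSymScheme.nonempty scheme i | IsSymScheme.nonempty scheme j
-- `A_a` and `A_b` survive the fusion unchanged, so the entries of their product are constant on the
-- fused relation, which contains a pair from each of `A_i` and `A_j`.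
... | x , y , refl | x′ , y′ , refl = begin
  p a b (R x y)                               ≡⟨ unfused x y ⟩
  p′ (f a) (f b) (f (R x y))                  ≡⟨ cong (p′ (f a) (f b)) (Equivalence.from (kernel _ _) (inj₂ (inj₁ (refl , refl)))) ⟩
  p′ (f a) (f b) (f (R x′ y′))                ≡⟨ unfused x′ y′ ⟨
  p a b (R x′ y′)                             ∎
  where
  open ≡-Reasoning
  open Scheme R scheme using (p; p-count)
  open Scheme (recolour f R) fusion using () renaming (p to p′; p-count to p′-count)
  singleton : ∀ {c} → c ≢ i → c ≢ j → ∀ l → (l ≡ c) ⇔ (f l ≡ f c)
  singleton {c} c≢i c≢j l = mk⇔ (cong f) λ fl≡fc → only (Equivalence.to (kernel l c) fl≡fc)
    where
    only : l ≡ c ⊎ (l ≡ i × c ≡ j) ⊎ (l ≡ j × c ≡ i) → l ≡ c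
    only (inj₁ l≡c) = l≡c
    only (inj₂ (inj₁ (_ , c≡j))) = contradiction c≡j c≢j
    only (inj₂ (inj₂ (_ , c≡i))) = contradiction c≡i c≢i
  unfused : ∀ x y → p a b (R x y) ≡ p′ (f a) (f b) (f (R x y))
  unfused x y = trans (sym (p-count a b x y)) (trans (sum-cong-≗ (λ z → cong₂ _*_
      (⟦⟧-cong (singleton a≢i a≢j (R x z)) (R x z ≟ a) (f (R x z) ≟ f a))
      (⟦⟧-cong (singleton b≢i b≢j (R z y)) (R z y ≟ b) (f (R z y) ≟ f b))))
    (p′-count (f a) (f b) x y))

Fuses-sym : ∀ {v d} {R : Colouring v d} {i j} → Fuses R i j → Fuses R j i
Fuses-sym {d = suc d} {i = i} {j} (i≢j , i≢0 , j≢0 , f , kernel , fusion) =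
  ≢-sym i≢j , j≢0 , i≢0 , f
  , (λ k l → mk⇔ (λ e → swapped (Equivalence.to (kernel k l) e)) (λ e → Equivalence.from (kernel k l) (swapped e)))
  , fusion
  where
  swapped : ∀ {A B C : Set} → A ⊎ B ⊎ C → A ⊎ C ⊎ B
  swapped (inj₁ a) = inj₁ a
  swapped (inj₂ (inj₁ b)) = inj₂ (inj₂ b)
  swapped (inj₂ (inj₂ c)) = inj₂ (inj₁ c)

Fuses-irrefl : ∀ {v d} {R : Colouring v d} {i} → ¬ Fuses R i i
Fuses-irrefl {d = suc d} (i≢i , _) = i≢i refl

-- Applying the graph arguments to the scheme.

module Assembly {v d : ℕ} (R : Colouring v d) (scheme : IsSymScheme R)
  (connected : Connected (FRAdj R)) (¬path : ¬ IsPath (FRAdj R))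
  {a₀ b₀ c₀ : Fin d} (a₀≢b₀ : a₀ ≢ b₀) (a₀≢c₀ : a₀ ≢ c₀) (b₀≢c₀ : b₀ ≢ c₀) where

  open Scheme R scheme
  open Graph (FRAdj R) Fuses-sym Fuses-irrefl connected

  suc-≢ : {a b : Fin d} → a ≢ b → suc a ≢ suc b
  suc-≢ a≢b refl = a≢b refl

  pred-≢ : {a b : Fin d} → suc a ≢ suc b → a ≢ b
  pred-≢ a≢b refl = a≢b refl

  Q⁺ : Fin d → Fin d → Fin d → ℕ
  Q⁺ a b c = Q (suc a) (suc b) (suc c)

  Q⁺-slide : ∀ {a b x y} → FRAdj R x y → a ≢ x → a ≢ y → b ≢ x → b ≢ y → Q⁺ a b x ≡ Q⁺ a b y
  Q⁺-slide x~y a≢x a≢y b≢x b≢y =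
    Q-cong (fusing⇒interchangeable scheme x~y (suc-≢ a≢x) (suc-≢ a≢y) (suc-≢ b≢x) (suc-≢ b≢y))

  open Tokens Q⁺ (λ a b c → Q-rotate (suc a) (suc b) (suc c)) (λ a b c → Q-swap (suc a) (suc b) (suc c)) Q⁺-slide

  k⁺ : Fin d → ℕ
  k⁺ a = k (suc a)

  -- The scaled constant q₀; `Q-distinct` makes the reference triple immaterial.
  q : ℕ
  q = Q⁺ a₀ b₀ c₀

  N : ℕ
  N = sum k⁺

  -- k_a (Q_aab - q), shifted by the constant q N to stay in ℕ; no truncation occurs since k_a ≤ N.
  w : Fin d → Fin d → ℕ
  w a b = k⁺ a * Q⁺ a a b + q * (N ∸ k⁺ a)

  -- In `Q-sum-nontrivial` all terms except those at `a` and `b` have `Q⁺` equal to `q`. This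
  -- determines k_a Q_aab + k_b Q_bba up to terms that the shift in `w` absorbs.
  w-balance : ∀ {a b} → a ≢ b → w a b + w b a ≡ M * M + N * q
  -- The amount added to both sides lets each `N ∸ k⁺` recombine to `N`, so that nothing is
  -- subtracted.
  w-balance {a} {b} a≢b = ℕ.+-cancelʳ-≡ (N * q + (k⁺ a * q + k⁺ b * q)) _ _ (begin
    w a b + w b a + (N * q + (k⁺ a * q + k⁺ b * q))
      ≡⟨ regroup (k⁺ a * Q⁺ a a b) (k⁺ b * Q⁺ b b a) q (N ∸ k⁺ a) (N ∸ k⁺ b) N (k⁺ a) (k⁺ b) ⟩
    N * q + (k⁺ a * Q⁺ a a b + k⁺ b * Q⁺ b b a) + (q * (N ∸ k⁺ a + k⁺ a) + q * (N ∸ k⁺ b + k⁺ b))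
      ≡⟨ cong₂ (λ s t → N * q + (k⁺ a * Q⁺ a a b + k⁺ b * Q⁺ b b a) + (q * s + q * t))
               (ℕ.m∸n+n≡m (term≤sum k⁺ a)) (ℕ.m∸n+n≡m (term≤sum k⁺ b)) ⟩
    N * q + (k⁺ a * Q⁺ a a b + k⁺ b * Q⁺ b b a) + (q * N + q * N)
      ≡⟨ cong (_+ (q * N + q * N)) (sym counted) ⟩
    M * M + (k⁺ a * q + k⁺ b * q) + (q * N + q * N)
      ≡⟨ collect (M * M) (k⁺ a * q + k⁺ b * q) q N ⟩
    M * M + N * q + (N * q + (k⁺ a * q + k⁺ b * q)) ∎)
    where
    open ≡-Reasoning
    regroup : ∀ u v q s t N k l → u + q * s + (v + q * t) + (N * q + (k * q + l * q))
                                ≡ N * q + (u + v) + (q * (s + k) + q * (t + l))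
    regroup = solve-∀
    collect : ∀ u v q N → u + v + (q * N + q * N) ≡ u + N * q + (N * q + v)
    collect = solve-∀
    counted : M * M + (k⁺ a * q + k⁺ b * q) ≡ N * q + (k⁺ a * Q⁺ a a b + k⁺ b * Q⁺ b b a)
    counted = begin
      M * M + (k⁺ a * q + k⁺ b * q)
        ≡⟨ cong (_+ (k⁺ a * q + k⁺ b * q)) (Q-sum-nontrivial (suc-≢ a≢b)) ⟨
      sum (λ c → k⁺ c * Q⁺ c a b) + (k⁺ a * q + k⁺ b * q)
        ≡⟨ sum-agree-off₂ a b a≢b (λ c c≢a c≢b → cong (k⁺ c *_)
             (Q-distinct (c≢a , c≢b , a≢b) (a₀≢b₀ , a₀≢c₀ , b₀≢c₀))) ⟩
      sum (λ c → k⁺ c * q) + (k⁺ a * Q⁺ a a b + k⁺ b * Q⁺ b a b)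
        ≡⟨ cong₂ (λ s t → s + (k⁺ a * Q⁺ a a b + k⁺ b * t))
             (*-distribʳ-sum q k⁺) (Q-rotate (suc b) (suc b) (suc a)) ⟨
      N * q + (k⁺ a * Q⁺ a a b + k⁺ b * Q⁺ b b a) ∎

  -- Locality of `w` is a slide with both stationary tokens at `a`.
  open Weights w (λ a≢b c≢e → trans (w-balance a≢b) (sym (w-balance c≢e)))
    (λ {a} b~c a≢b a≢c → cong (λ t → k⁺ a * t + q * (N ∸ k⁺ a)) (Q⁺-slide b~c a≢b a≢c a≢b a≢c))

  -- As Γ is not a path, `w a` is constant off `a`; the shift and the valency cancel.
  Q⁺-diagonal : ∀ {a b c} → a ≢ b → a ≢ c → Q⁺ a a b ≡ Q⁺ a a c
  Q⁺-diagonal {a} a≢b a≢c = ℕ.*-cancelˡ-≡ _ _ (k⁺ a) {{k≢0 (suc a)}}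
    (ℕ.+-cancelʳ-≡ (q * (N ∸ k⁺ a)) _ _ (not-path⇒constant ¬path a≢b a≢c))

  -- A trivial argument makes both sides vanish, equal arguments are `Q⁺-diagonal`, and distinct
  -- ones are a token move.
  all-interchangeable : ∀ {i j} → i ≢ zero → j ≢ zero → Interchangeable i j
  all-interchangeable {zero} i≢0 _ = contradiction refl i≢0
  all-interchangeable {suc i} {zero} _ j≢0 = contradiction refl j≢0
  all-interchangeable {suc i} {suc j} _ _ {zero} {b} _ _ b≢i b≢j = trans (p-zero b≢i) (sym (p-zero b≢j))
  all-interchangeable {suc i} {suc j} _ _ {suc a} {zero} a≢i a≢j _ _ = begin
    p (suc a) zero (suc i) ≡⟨ p-comm (suc a) zero (suc i) ⟩
    p zero (suc a) (suc i) ≡⟨ trans (p-zero a≢i) (sym (p-zero a≢j)) ⟩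
    p zero (suc a) (suc j) ≡⟨ p-comm zero (suc a) (suc j) ⟩
    p (suc a) zero (suc j) ∎
    where open ≡-Reasoning
  all-interchangeable {suc i} {suc j} _ _ {suc a} {suc b} a≢i a≢j b≢i b≢j with a ≟ b
  ... | yes refl = Q-cancel (Q⁺-diagonal (pred-≢ a≢i) (pred-≢ a≢j))
  ... | no a≢b = Q-cancel (Q-move a≢b (pred-≢ a≢i) (pred-≢ b≢i) (pred-≢ a≢j) (pred-≢ b≢j))

  amorphic : Amorphic R
  amorphic d′ f partition = Fusion.fusion-scheme all-interchangeable f partition

theorem6p3 : (v d : ℕ) (R : Colouring v d) → IsSymScheme R → d ≥ 3 →
    Connected (FRAdj R) → ¬ IsPath (FRAdj R) → Amorphic R
theorem6p3 v _ R scheme (s≤s (s≤s (s≤s _))) connected ¬path =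
  -- The bound d ≥ 3 supplies the three distinct relations that define `q`.
  Assembly.amorphic R scheme connected ¬path {zero} {suc zero} {suc (suc zero)} (λ ()) (λ ()) (λ ())
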